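{- Let $m$ be an integer and $n>0$ an integer. (1) The ordered root quadruples $\mathbf v=(w,x,y,z)$, $w\le x\le y\le z$, with $L(\mathbf v)>0$, $Q_{\mathcal D}(\mathbf v)=4m$ and smallest element $w=-n$ are in one-to-one correspondence with the integral binary quadratic forms $[A,B,C]=AX^2+2BXY+CY^2$ (primitive or imprimitive) of discriminant $\Delta=4B^2-4AC=-4n^2+4m$ satisfying $0\le 2B\le A\le C$; the correspondence is given by $$[A,B,C]=\left[-n+x,\ \tfrac12(-n+x+y-z),\ -n+y\right].$$ (2) If $\Delta=-4n^2+4m<0$, then $N_{\mathrm{root}}(4m;-n)=\widetilde{h^{\pm}}(-4(n^2-m))$.
   Context: $Q_{\mathcal D}(a,b,c,d)=2(a^2+b^2+c^2+d^2)-(a+b+c+d)^2$; $L(\mathbf v)=a+b+c+d$; $|\mathbf v|=|a|+|b|+|c|+|d|$. $\mathbf S_i$ ($i=1,\dots,4$) is the integer matrix replacing the $i$-th coordinate $a_i$ of a quadruple by $2\sum_{j\ne i}a_j-a_i$, other coordinates fixed. An integer quadruple is reduced if no $\mathbf S_i$ strictly decreases $|\cdot|$; a reduced quadruple ordered as $a\le b\le c\le d$ with $L\ge0$ is a root quadruple if $a+b+c\ge d>0$. $N_{\mathrm{root}}(k;-n)$ is the number of integer root quadruples $(w,x,y,z)$ with $Q_{\mathcal D}=k$, $w+x+y+z>0$ and smallest element $w=-n$. For a discriminant $\Delta<0$, $\widetilde{h^{\pm}}(\Delta)$ is the number of integral binary quadratic forms $[A,B,C]=AT^2+2BTU+CU^2$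 (primitive or imprimitive) with $4B^2-4AC=\Delta$ and $0\le2B\le A\le C$ (the $GL(2,\mathbb Z)$-reduced forms; equivalently the number of $GL(2,\mathbb Z)$-equivalence classes of positive definite forms of discriminant $\Delta$). -}

module Defs where

open import Data.Fin.Base using (Fin)
open import Data.Integer.Base using (ℤ; +_; 0ℤ; _+_; _-_; _*_; _^_; _≤_; _<_; ∣_∣)
open import Data.Nat.Base as ℕ using (ℕ)
open import Data.Product.Base using (_×_; proj₁; Σ)
open import Data.Vec.Base as Vec using (Vec; []; _∷_; lookup; removeAt; _[_]≔_)
open import Function.Bundles using (Bijection)
open import Level using (0ℓ)
open import Relation.Binary.Bundles using (Setoid)
import Relation.Binary.Construct.On as On
open import Relation.Binary.PropositionalEquality using (_≡_; setoid)
open import Relation.Nullary.Negation.Core using (¬_)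

-- The subset { x ∈ A ∣ P x }: membership proofs are ignored by its equality,
-- so bijections and cardinalities count elements of A, not proofs.
Subset : {A : Set} → (A → Set) → Setoid 0ℓ 0ℓ
Subset {A} P = On.setoid {B = Σ A P} (setoid A) proj₁

-- "S is finite with exactly N elements".  Counting is relational because a
-- count such as N_root(k; -n) need not be finite for every k and n.
HasCardinality : Setoid 0ℓ 0ℓ → ℕ → Set
HasCardinality S N = Bijection S (setoid (Fin N))

Quadruple : Set
Quadruple = Vec ℤ 4

sumℤ : ∀ {n} → Vec ℤ n → ℤ
sumℤ = Vec.foldr′ _+_ 0ℤ

L : Quadruple → ℤ
L = sumℤ

Q-D : Quadruple → ℤ
Q-D v = + 2 * sumℤ (Vec.map (_^ 2) v) - L v ^ 2

norm : Quadruple → ℕ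
norm v = Vec.sum (Vec.map ∣_∣ v)

-- The action of the matrix S_i:  a_i ↦ 2 Σ_{j ≠ i} a_j - a_i.
S : Fin 4 → Quadruple → Quadruple
S i v = v [ i ]≔ (+ 2 * sumℤ (removeAt v i) - lookup v i)

Reduced : Quadruple → Set
Reduced v = ∀ i → ¬ (norm (S i v) ℕ.< norm v)

Ordered : Quadruple → Set
Ordered (a ∷ b ∷ c ∷ d ∷ []) = a ≤ b × b ≤ c × c ≤ d

IsRoot : Quadruple → Set
IsRoot v@(a ∷ b ∷ c ∷ d ∷ []) =
  Reduced v × Ordered v × 0ℤ ≤ L v × d ≤ a + b + c × 0ℤ < d

-- Root quadruples are ordered, so the head is the smallest element.
IsRootWith : (k s : ℤ) → Quadruple → Set
IsRootWith k s v = IsRoot v × 0ℤ < L v × Q-D v ≡ k × Vec.head v ≡ s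

RootQuadruples : (k s : ℤ) → Setoid 0ℓ 0ℓ
RootQuadruples k s = Subset (IsRootWith k s)

-- N-root k s N  means  N_root(k; s) = N.
N-root : (k s : ℤ) → ℕ → Set
N-root k s = HasCardinality (RootQuadruples k s)

-- [ A , B , C ] is the form A T² + 2B T U + C U²: the middle coefficient is 2B.
record Form : Set where
  constructor [_,_,_]
  field
    A B C : ℤ

disc : Form → ℤ
disc [ A , B , C ] = + 4 * B ^ 2 - + 4 * A * C

IsReducedForm : Form → Set
IsReducedForm [ A , B , C ] = 0ℤ ≤ + 2 * B × + 2 * B ≤ A × A ≤ C

ReducedForms : (Δ : ℤ) → Setoid 0ℓ 0ℓ
ReducedForms Δ = Subset λ q → disc q ≡ Δ × IsReducedForm q

-- h̃± Δ N  means that the GL(2,ℤ) class number of all (primitive or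
-- imprimitive) forms of discriminant Δ < 0, counted by reduced forms, is N.
h̃± : (Δ : ℤ) → ℕ → Set
h̃± Δ = HasCardinality (ReducedForms Δ)

{-# OPTIONS --safe #-}
-- The inverse correspondence is the explicit injective map
--   [A,B,C] ↦ (-n , A+n , C+n , n+A+C-2B),
-- for which Q = 4n² + disc.  Under it y ≤ z, x ≤ y and z ≤ w+x+y read 2B ≤ A,
-- A ≤ C and 0 ≤ 2B.  It reaches every root quadruple because Q = 4m makes L²,
-- hence L, even, so that B = L/2 - z is an integer.  The ordering together with
-- 0 ≤ L and 2z ≤ L already implies that no S_i decreases the norm.
-- For Δ < 0 a reduced form has A ≥ 1 and 4B² ≤ A² ≤ AC, so
-- C ≤ AC ≤ 3AC ≤ 4AC - 4B² = -Δ, which leaves finitely many forms.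
module Submission where

open import Defs
open import Data.Fin.Base using (zero; suc)
open import Data.Fin.Patterns using (0F; 1F; 2F; 3F)
open import Data.Integer.Base using (ℤ; +_; -[1+_]; +[1+_]; +0; -_; 0ℤ; 1ℤ; _+_; _-_; _*_; _^_; _≤_; _<_; ∣_∣; +≤+; NonNegative; nonNegative)
open import Data.Integer.Divisibility.Signed using (_∣_; divides; ∣ᵤ⇒∣; ∣⇒∣ᵤ)
open import Data.Integer.Properties
open import Data.Integer.Tactic.RingSolver using (solve-∀)
open import Data.List.Base using (List; map; upTo; filter; length; lookup; cartesianProduct; cartesianProductWith)
open import Data.List.Membership.Propositional using (_∈_)
open import Data.List.Membership.Propositional.Properties using (∈-map⁺; ∈-upTo⁺; ∈-cartesianProduct⁺; ∈-cartesianProductWith⁺; ∈-filter⁺; ∈-filter⁻; ∈-lookup)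
open import Data.List.Relation.Unary.All as All using ()
open import Data.List.Relation.Unary.AllPairs using (_∷_)
open import Data.List.Relation.Unary.Any using (index)
open import Data.List.Relation.Unary.Any.Properties using (lookup-index)
open import Data.List.Relation.Unary.Unique.Propositional using (Unique)
import Data.List.Relation.Unary.Unique.Propositional.Properties as Unique
import Data.Nat.Base as ℕ
import Data.Nat.Divisibility as ℕ
open import Data.Nat.Primality using (euclidsLemma; prime[2])
import Data.Nat.Properties as ℕ
open import Data.Product.Base using (_×_; _,_; proj₁; proj₂; Σ-syntax; ∃-syntax)
open import Data.Sum.Base using (reduce)
open import Data.Vec.Base as Vec using (Vec; []; _∷_; removeAt; _[_]≔_)
open import Function.Base using (_∘_)
open import Function.Bundles using (Bijection)
import Function.Construct.Composition as Composition
open import Level using (0ℓ)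
open import Relation.Binary.Bundles using (Setoid)
open import Relation.Binary.PropositionalEquality using (_≡_; refl; sym; trans; cong; cong₂; subst; setoid)
open import Relation.Nullary.Decidable using (_×-dec_)
open import Relation.Nullary.Negation using (contradiction)
open import Relation.Unary using (Decidable)

-- Bijections and cardinalities of subsets.

-- `preimage` may depend on the membership proof, so two proofs for one element could yield
-- different witnesses. Injectivity of `f` identifies them, which makes `to` respect the equality of
-- the subset. Here `T` is instantiated both with list positions and with reduced forms.
subset-bijection : ∀ {A : Set} {P : A → Set} (T : Setoid 0ℓ 0ℓ) → let open Setoid T in
  (f : Carrier → A) → (∀ {s t} → s ≈ t → f s ≡ f t) → (∀ {s t} → f s ≡ f t → s ≈ t) →
  (∀ t → P (f t)) → (∀ {a} → P a → ∃[ t ] f t ≡ a) →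
  Bijection (Subset P) T
subset-bijection T f f-cong f-injective f∈P preimage = record
  { to        = λ (_ , p) → proj₁ (preimage p)
  ; cong      = λ {(_ , p)} {(_ , q)} eq →
      f-injective (trans (proj₂ (preimage p)) (trans eq (sym (proj₂ (preimage q)))))
  ; bijective =
      (λ {(_ , p)} {(_ , q)} eq →
        trans (sym (proj₂ (preimage p))) (trans (f-cong eq) (proj₂ (preimage q)))) ,
      (λ t → (f t , f∈P t) , λ {(_ , p)} eq → f-injective (trans (proj₂ (preimage p)) eq))
  }

lookup-injective : ∀ {A : Set} {xs : List A} → Unique xs →
  ∀ {i j} → lookup xs i ≡ lookup xs j → i ≡ j
lookup-injective (_  ∷ _) {zero}  {zero}  _  = refl
lookup-injective (x∉ ∷ _) {zero}  {suc j} eq = contradiction eq (All.lookup x∉ (∈-lookup j))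
lookup-injective (x∉ ∷ _) {suc i} {zero}  eq = contradiction (sym eq) (All.lookup x∉ (∈-lookup i))
lookup-injective (_  ∷ u) {suc i} {suc j} eq = cong suc (lookup-injective u eq)

-- Filtering a duplicate-free list that covers `P` enumerates the subset by list positions,
-- injectively because no entry repeats.
subset-cardinality : ∀ {A : Set} {P : A → Set} (P? : Decidable P) {xs : List A} → Unique xs →
  (∀ {a} → P a → a ∈ xs) → HasCardinality (Subset P) (length (filter P? xs))
subset-cardinality P? {xs} xs! P⊆xs =
  subset-bijection (setoid _) (lookup (filter P? xs)) (cong _)
    (lookup-injective (Unique.filter⁺ P? xs!))
    (λ i → proj₂ (∈-filter⁻ P? {xs = xs} (∈-lookup i)))
    (λ p → let a∈ = ∈-filter⁺ P? (P⊆xs p) p in index a∈ , sym (lookup-index a∈))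

-- Reducedness from the root inequalities.

-- Turns the transfer of linear inequalities into an identity between differences, which the ring
-- solver can check.
≤-by-difference : ∀ {i j k l} → i ≤ j → j - i ≡ l - k → k ≤ l
≤-by-difference i≤j eq = 0≤i-j⇒j≤i (subst (0ℤ ≤_) eq (i≤j⇒0≤j-i i≤j))

∣∣-mono : ∀ i j → i ≤ j → - i ≤ j → ∣ i ∣ ℕ.≤ ∣ j ∣
∣∣-mono (+ _)    _ (+≤+ i≤j) _          = i≤j
∣∣-mono -[1+ _ ] _ _         (+≤+ -i≤j) = -i≤j

sumℤ-removeAt : ∀ {n} (v : Vec ℤ (ℕ.suc n)) i → sumℤ (removeAt v i) + Vec.lookup v i ≡ sumℤ v
sumℤ-removeAt (x ∷ v) zero = +-comm (sumℤ v) x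
sumℤ-removeAt (x ∷ v@(_ ∷ _)) (suc i) =
  trans (+-assoc x _ _) (cong (λ s → x + s) (sumℤ-removeAt v i))

sum-∣∣-mono-update : ∀ {n} (v : Vec ℤ n) i {b} → ∣ Vec.lookup v i ∣ ℕ.≤ ∣ b ∣ →
  Vec.sum (Vec.map ∣_∣ v) ℕ.≤ Vec.sum (Vec.map ∣_∣ (v [ i ]≔ b))
sum-∣∣-mono-update (x ∷ v) zero    le = ℕ.+-monoˡ-≤ _ le
sum-∣∣-mono-update (x ∷ v) (suc i) le = ℕ.+-monoʳ-≤ ∣ x ∣ (sum-∣∣-mono-update v i le)

-- With `s` the sum of the other coordinates and `L = s + a`, the new coordinate `b = 2s - a`
-- satisfies `b - a = 2 (L - 2a)` and `b + a = (L - 2a) + L`. Both are nonnegative, so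
-- `- b ≤ a ≤ b`.
∣a∣≤∣2s-a∣ : ∀ s a → 0ℤ ≤ s + a → + 2 * a ≤ s + a → ∣ a ∣ ℕ.≤ ∣ + 2 * s - a ∣
∣a∣≤∣2s-a∣ s a 0≤s+a 2a≤s+a = ∣∣-mono a (+ 2 * s - a)
    (≤-by-difference (+-mono-≤ 2a≤s+a 2a≤s+a) (i₁ s a))
    (≤-by-difference (+-mono-≤ 2a≤s+a 0≤s+a) (i₂ s a))
  where
  i₁ : ∀ s a → (s + a + (s + a)) - (+ 2 * a + + 2 * a) ≡ (+ 2 * s - a) - a
  i₁ = solve-∀
  i₂ : ∀ s a → (s + a + (s + a)) - (+ 2 * a + 0ℤ) ≡ (+ 2 * s - a) - (- a)
  i₂ = solve-∀

reduced : ∀ v → 0ℤ ≤ L v → (∀ i → + 2 * Vec.lookup v i ≤ L v) → Reduced v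
reduced v 0≤L 2v≤L i = ℕ.≤⇒≯ (sum-∣∣-mono-update v i
  (∣a∣≤∣2s-a∣ (sumℤ (removeAt v i)) (Vec.lookup v i)
    (subst (0ℤ ≤_) L≡ 0≤L) (subst (+ 2 * Vec.lookup v i ≤_) L≡ (2v≤L i))))
  where
  L≡ = sym (sumℤ-removeAt v i)

ordered⇒reduced : ∀ {a b c d} → Ordered (a ∷ b ∷ c ∷ d ∷ []) →
  0ℤ ≤ L (a ∷ b ∷ c ∷ d ∷ []) → d ≤ a + b + c → Reduced (a ∷ b ∷ c ∷ d ∷ [])
ordered⇒reduced {a} {b} {c} {d} (a≤b , b≤c , c≤d) 0≤L d≤a+b+c = reduced v 0≤L λ i →
    -- Each coordinate is at most `d`, and `d ≤ a + b + c` is the same as `2d ≤ L`.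
    ≤-trans (*-monoˡ-≤-nonNeg (+ 2) (≤-last i)) (≤-by-difference d≤a+b+c (identity a b c d))
  where
  v = a ∷ b ∷ c ∷ d ∷ []
  ≤-last : ∀ i → Vec.lookup v i ≤ d
  ≤-last 0F = ≤-trans a≤b (≤-trans b≤c c≤d)
  ≤-last 1F = ≤-trans b≤c c≤d
  ≤-last 2F = c≤d
  ≤-last 3F = ≤-refl
  identity : ∀ a b c d → (a + b + c) - d ≡ (a + (b + (c + (d + 0ℤ)))) - + 2 * d
  identity = solve-∀

-- The explicit map from forms to quadruples, and parity.

2∣i²⇒2∣i : ∀ i → + 2 ∣ i ^ 2 → + 2 ∣ i
2∣i²⇒2∣i i 2∣i² = ∣ᵤ⇒∣ (reduce (euclidsLemma ∣ i ∣ ∣ i ∣ prime[2]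
  (subst (2 ℕ.∣_) (abs-* i i) (∣⇒∣ᵤ (subst (λ j → + 2 ∣ i * j) (*-identityʳ i) 2∣i²)))))

quadruple : ℤ → Form → Quadruple
quadruple n [ A , B , C ] = - n ∷ A + n ∷ C + n ∷ n + A + C - + 2 * B ∷ []

-- The middle coefficient is left doubled, so the half in the correspondence formula involves no
-- division.
quadruple-inverse : ∀ n {w x y z} {q : Form} → quadruple n q ≡ w ∷ x ∷ y ∷ z ∷ [] →
  let open Form q in A ≡ - n + x × + 2 * B ≡ - n + x + y - z × C ≡ - n + y
quadruple-inverse n {q = [ A , B , C ]} refl = outer A n , middle A B C n , outer C n
  where
  outer : ∀ A n → A ≡ - n + (A + n)
  outer = solve-∀
  middle : ∀ A B C n → + 2 * B ≡ - n + (A + n) + (C + n) - (n + A + C - + 2 * B)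
  middle = solve-∀

quadruple-injective : ∀ n {q r} → quadruple n q ≡ quadruple n r → q ≡ r
quadruple-injective n {q} {r} eq
  -- Both forms are read off the same quadruple `quadruple n r`; the entries `B` agree after
  -- cancelling 2.
  with A≡  , 2B≡  , C≡  ← quadruple-inverse n {q = q} eq
     | A′≡ , 2B′≡ , C′≡ ← quadruple-inverse n {q = r} refl
  with refl ← trans A≡ (sym A′≡)
     | refl ← *-cancelˡ-≡ (+ 2) (Form.B q) (Form.B r) (trans 2B≡ (sym 2B′≡))
     | refl ← trans C≡ (sym C′≡) = refl

Q-D-quadruple : ∀ n q → Q-D (quadruple n q) ≡ disc q + + 4 * n ^ 2
Q-D-quadruple n [ A , B , C ] = identity n A B C
  where
  -- i ^ 2 is definitionally i * (i * 1ℤ).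
  identity : ∀ n A B C → let z = n + A + C - + 2 * B ; s = - n + (A + n + (C + n + (z + 0ℤ))) in
    + 2 * (- n * (- n * 1ℤ) + ((A + n) * ((A + n) * 1ℤ) + ((C + n) * ((C + n) * 1ℤ) + (z * (z * 1ℤ) + 0ℤ)))) - s * (s * 1ℤ)
    ≡ + 4 * (B * (B * 1ℤ)) - + 4 * A * C + + 4 * (n * (n * 1ℤ))
  identity = solve-∀

Q-D⇒disc : ∀ m n q → Q-D (quadruple n q) ≡ + 4 * m → disc q ≡ - (+ 4) * n ^ 2 + + 4 * m
Q-D⇒disc m n q eq = trans (identity (disc q) (n ^ 2))
  (cong (λ k → - (+ 4) * n ^ 2 + k) (trans (sym (Q-D-quadruple n q)) eq))
  where
  identity : ∀ d s → d ≡ - (+ 4) * s + (d + + 4 * s)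
  identity = solve-∀

disc⇒Q-D : ∀ m n q → disc q ≡ - (+ 4) * n ^ 2 + + 4 * m → Q-D (quadruple n q) ≡ + 4 * m
disc⇒Q-D m n q eq = trans (Q-D-quadruple n q) (trans (cong (_+ + 4 * n ^ 2) eq) (identity m (n ^ 2)))
  where
  identity : ∀ m s → - (+ 4) * s + + 4 * m + + 4 * s ≡ + 4 * m
  identity = solve-∀

IsRoot⇒IsReducedForm : ∀ n q → IsRoot (quadruple n q) → IsReducedForm q
IsRoot⇒IsReducedForm n [ A , B , C ] (_ , (_ , x≤y , y≤z) , _ , z≤w+x+y , _) =
  ≤-by-difference z≤w+x+y (i₁ n A B C) , ≤-by-difference y≤z (i₂ n A B C) , ≤-by-difference x≤y (i₃ n A C)
  where
  i₁ : ∀ n A B C → - n + (A + n) + (C + n) - (n + A + C - + 2 * B) ≡ + 2 * B - 0ℤ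
  i₁ = solve-∀
  i₂ : ∀ n A B C → n + A + C - + 2 * B - (C + n) ≡ A - + 2 * B
  i₂ = solve-∀
  i₃ : ∀ n A C → C + n - (A + n) ≡ C - A
  i₃ = solve-∀

IsReducedForm⇒IsRoot : ∀ n q → 0ℤ < n → IsReducedForm q →
  IsRoot (quadruple n q) × 0ℤ < L (quadruple n q)
IsReducedForm⇒IsRoot n [ A , B , C ] 0<n (0≤2B , 2B≤A , A≤C) =
  (ordered⇒reduced ordered (<⇒≤ 0<L) z≤w+x+y , ordered , <⇒≤ 0<L , z≤w+x+y , 0<z) , 0<L
  where
  0≤A = ≤-trans 0≤2B 2B≤A
  z = n + A + C - + 2 * B

  i₁ : ∀ n A → (n + n + A) - (0ℤ + 0ℤ + 0ℤ) ≡ A + n - (- n)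
  i₁ = solve-∀
  i₂ : ∀ n A B C → A - + 2 * B ≡ n + A + C - + 2 * B - (C + n)
  i₂ = solve-∀
  i₃ : ∀ n A B C → + 2 * B - 0ℤ ≡ - n + (A + n) + (C + n) - (n + A + C - + 2 * B)
  i₃ = solve-∀
  i₄ : ∀ n A C B → n + (A - + 2 * B + C) ≡ n + A + C - + 2 * B
  i₄ = solve-∀
  i₅ : ∀ n A C z → z + (- n + (A + n) + (C + n)) ≡ - n + (A + n + (C + n + (z + 0ℤ)))
  i₅ = solve-∀

  ordered : Ordered (quadruple n [ A , B , C ])
  -- The inequality `w ≤ x` comes from `x - w = 2n + A`, a sum of nonnegative terms.
  ordered = ≤-by-difference (+-mono-≤ (+-mono-≤ (<⇒≤ 0<n) (<⇒≤ 0<n)) 0≤A) (i₁ n A)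
          , +-monoˡ-≤ n A≤C
          , ≤-by-difference 2B≤A (i₂ n A B C)

  z≤w+x+y : z ≤ - n + (A + n) + (C + n)
  z≤w+x+y = ≤-by-difference 0≤2B (i₃ n A B C)

  0<z : 0ℤ < z
  -- Strictness comes from `n`: the other summands `A - 2B` and `C` of `z` are nonnegative.
  0<z = subst (0ℤ <_) (i₄ n A C B)
    (+-mono-<-≤ 0<n (+-mono-≤ (i≤j⇒0≤j-i 2B≤A) (≤-trans 0≤A A≤C)))

  0<L : 0ℤ < L (quadruple n [ A , B , C ])
  -- Here `L = z + (w + x + y)`, where `w + x + y ≥ z > 0`.
  0<L = subst (0ℤ <_) (i₅ n A C z) (+-mono-< 0<z (<-≤-trans 0<z z≤w+x+y))

Q-D≡4m⇒2∣L : ∀ m v → Q-D v ≡ + 4 * m → + 2 ∣ L v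
-- With `s` the sum of squares, `Q = 4m` says `L² = 2s - 4m`, whose half is the witness.
Q-D≡4m⇒2∣L m v eq = 2∣i²⇒2∣i (L v) (divides (s - + 2 * m)
  (trans (i₁ s (L v ^ 2)) (trans (cong (λ k → + 2 * s - k) eq) (i₂ s m))))
  where
  s = sumℤ (Vec.map (_^ 2) v)
  i₁ : ∀ s l → l ≡ + 2 * s - (+ 2 * s - l)
  i₁ = solve-∀
  i₂ : ∀ s m → + 2 * s - + 4 * m ≡ (s - + 2 * m) * + 2
  i₂ = solve-∀

quadruple-section : ∀ n x y z → + 2 ∣ L (- n ∷ x ∷ y ∷ z ∷ []) →
  ∃[ q ] quadruple n q ≡ - n ∷ x ∷ y ∷ z ∷ []
quadruple-section n x y z (divides b L≡2b) =
  -- The numerator `- n + x + y - z` equals `L - 2z = 2 (b - z)`, hence the middle entry.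
  [ - n + x , b - z , - n + y ] ,
  cong₂ (λ x′ yz → - n ∷ x′ ∷ yz) (outer n x) (cong₂ (λ y′ z′ → y′ ∷ z′ ∷ []) (outer n y) last)
  where
  outer : ∀ n x → - n + x + n ≡ x
  outer = solve-∀
  i₁ : ∀ n x y z b → n + (- n + x) + (- n + y) - + 2 * (b - z) ≡ - n + x + y + + 2 * z - b * + 2
  i₁ = solve-∀
  i₂ : ∀ n x y z → - n + x + y + + 2 * z - (- n + (x + (y + (z + 0ℤ)))) ≡ z
  i₂ = solve-∀
  last : n + (- n + x) + (- n + y) - + 2 * (b - z) ≡ z
  last = trans (i₁ n x y z b) (trans (cong (λ k → - n + x + y + + 2 * z - k) (sym L≡2b)) (i₂ n x y z))

quadruple-surjective : ∀ m n v → Q-D v ≡ + 4 * m → Vec.head v ≡ - n → ∃[ q ] quadruple n q ≡ v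
quadruple-surjective m n v@(_ ∷ x ∷ y ∷ z ∷ []) eq refl =
  quadruple-section n x y z (Q-D≡4m⇒2∣L m v eq)

-- The one-to-one correspondence.

-- The equation beside the bijection records that the chosen form maps back to the given quadruple;
-- the coefficient formulas are later read off from it.
correspondence : ∀ m n → 0ℤ < n →
  Σ[ φ ∈ Bijection (RootQuadruples (+ 4 * m) (- n)) (ReducedForms (- (+ 4) * n ^ 2 + + 4 * m)) ]
    (∀ r → quadruple n (proj₁ (Bijection.to φ r)) ≡ proj₁ r)
correspondence m n 0<n =
  subset-bijection (ReducedForms _) (quadruple n ∘ proj₁) (cong (quadruple n)) (quadruple-injective n)
    sound (λ {v} → preimage v) ,
  λ (v , r) → proj₂ (preimage v r)
  where
  sound : ∀ ((q , _) : Setoid.Carrier (ReducedForms (- (+ 4) * n ^ 2 + + 4 * m))) →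
    IsRootWith (+ 4 * m) (- n) (quadruple n q)
  sound (q , d , red) with root , 0<L ← IsReducedForm⇒IsRoot n q 0<n red =
    root , 0<L , disc⇒Q-D m n q d , refl

  preimage : ∀ v → IsRootWith (+ 4 * m) (- n) v →
    Σ[ t ∈ Setoid.Carrier (ReducedForms (- (+ 4) * n ^ 2 + + 4 * m)) ] quadruple n (proj₁ t) ≡ v
  preimage v (root , _ , Q≡4m , head≡-n) with q , refl ← quadruple-surjective m n v Q≡4m head≡-n =
    (q , Q-D⇒disc m n q Q≡4m , IsRoot⇒IsReducedForm n q root) , refl

-- Finiteness of the reduced forms of negative discriminant.

reduced-form-bound : ∀ {Δ} q → Δ < 0ℤ → disc q ≡ Δ → IsReducedForm q → Form.C q ≤ - Δ
-- For `A = 0`, the bounds `0 ≤ 2B ≤ A` force `B = 0`, so the discriminant vanishes.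
reduced-form-bound [ +0 , B , C ] Δ<0 refl (0≤2B , 2B≤0 , _)
  with refl ← *-cancelˡ-≡ (+ 2) B 0ℤ (≤-antisym 2B≤0 0≤2B) = contradiction Δ<0 (<-irrefl refl)
reduced-form-bound [ A@(+[1+ _ ]) , B , C ] _ refl (0≤2B , 2B≤A , A≤C) = begin
  C                     ≡⟨ *-identityˡ C ⟨
  1ℤ * C                ≤⟨ *-monoʳ-≤-nonNeg C {1ℤ} {A} (+≤+ (ℕ.s≤s ℕ.z≤n)) ⟩
  -- The gap `- disc - AC` is `3AC - (2B)²`, nonnegative by two copies of `0 ≤ AC` and one of
  -- `(2B)² ≤ AC`.
  A * C                 ≤⟨ ≤-by-difference (+-mono-≤ (+-mono-≤ 0≤AC 0≤AC) 2B*2B≤AC) (identity A B C) ⟩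
  - disc [ A , B , C ]  ∎
  where
  open ≤-Reasoning
  0≤C = ≤-trans (+≤+ ℕ.z≤n) A≤C
  instance
    C-nonNeg : NonNegative C
    C-nonNeg = nonNegative 0≤C
    2B-nonNeg : NonNegative (+ 2 * B)
    2B-nonNeg = nonNegative 0≤2B
  0≤AC : 0ℤ ≤ A * C
  0≤AC = *-monoʳ-≤-nonNeg C {0ℤ} {A} (+≤+ ℕ.z≤n)
  2B*2B≤AC : + 2 * B * (+ 2 * B) ≤ A * C
  2B*2B≤AC = ≤-trans (*-monoʳ-≤-nonNeg (+ 2 * B) 2B≤A) (*-monoˡ-≤-nonNeg A (≤-trans 2B≤A A≤C))
  identity : ∀ A B C → (A * C + A * C + A * C) - (0ℤ + 0ℤ + + 2 * B * (+ 2 * B))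
    ≡ - (+ 4 * (B * (B * 1ℤ)) - + 4 * A * C) - A * C
  identity = solve-∀
reduced-form-bound [ -[1+ _ ] , B , C ] _ _ (0≤2B , 2B≤A , _) with () ← ≤-trans 0≤2B 2B≤A

naturals≤ : ℕ.ℕ → List ℤ
naturals≤ k = map +_ (upTo (ℕ.suc k))

∈-naturals≤ : ∀ {k i} → 0ℤ ≤ i → i ≤ + k → i ∈ naturals≤ k
∈-naturals≤ (+≤+ _) (+≤+ i≤k) = ∈-map⁺ +_ (∈-upTo⁺ (ℕ.s≤s i≤k))

formBox : ℕ.ℕ → List Form
formBox k = cartesianProductWith (λ A (B , C) → [ A , B , C ]) (naturals≤ k)
  (cartesianProduct (naturals≤ k) (naturals≤ k))

formBox-unique : ∀ k → Unique (formBox k)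
formBox-unique k = Unique.cartesianProductWith⁺ _ (λ where refl → refl , refl) u (Unique.cartesianProduct⁺ u u)
  where
  u : Unique (naturals≤ k)
  u = Unique.map⁺ +-injective (Unique.upTo⁺ (ℕ.suc k))

-- One bound confines all three coefficients: `0 ≤ B ≤ 2B ≤ A ≤ C ≤ - Δ`. Since `- Δ` is positive,
-- `∣ - Δ ∣` is the same bound as a natural number.
reduced-form∈formBox : ∀ {Δ} → Δ < 0ℤ → ∀ q → disc q ≡ Δ × IsReducedForm q → q ∈ formBox ∣ - Δ ∣
reduced-form∈formBox {Δ} Δ<0 q@([ A , B , C ]) (d , red@(0≤2B , 2B≤A , A≤C)) =
  ∈-cartesianProductWith⁺ _ (∈-naturals≤ 0≤A A≤k)
    (∈-cartesianProduct⁺ (∈-naturals≤ 0≤B (≤-trans B≤2B (≤-trans 2B≤A A≤k)))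
      (∈-naturals≤ (≤-trans 0≤A A≤C) C≤k))
  where
  0≤A = ≤-trans 0≤2B 2B≤A
  0≤B = *-cancelˡ-≤-pos 0ℤ B (+ 2) 0≤2B
  C≤k : C ≤ + ∣ - Δ ∣
  C≤k = subst (C ≤_) (sym (0≤i⇒+∣i∣≡i (neg-mono-≤ (<⇒≤ Δ<0)))) (reduced-form-bound q Δ<0 d red)
  A≤k = ≤-trans A≤C C≤k
  B≤2B : B ≤ + 2 * B
  B≤2B = ≤-by-difference 0≤B (identity B)
    where
    identity : ∀ B → B - 0ℤ ≡ + 2 * B - B
    identity = solve-∀

class-number : ∀ {Δ} → Δ < 0ℤ → ∃[ N ] h̃± Δ N
class-number {Δ} Δ<0 = _ , subset-cardinality
  (λ q → let open Form q in
    (disc q ≟ Δ) ×-dec (0ℤ ≤? + 2 * B) ×-dec (+ 2 * B ≤? A) ×-dec (A ≤? C))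
  (formBox-unique ∣ - Δ ∣) (λ {q} → reduced-form∈formBox Δ<0 q)

theorem4p1 : (m n : ℤ) → 0ℤ < n →
    let Δ = - (+ 4) * n ^ 2 + + 4 * m in
    (Σ[ φ ∈ Bijection (RootQuadruples (+ 4 * m) (- n)) (ReducedForms Δ) ]
    (∀ w x y z (r : IsRootWith (+ 4 * m) (- n) (w ∷ x ∷ y ∷ z ∷ [])) →
    let open Form (proj₁ (Bijection.to φ ((w ∷ x ∷ y ∷ z ∷ []) , r))) in
    A ≡ - n + x × + 2 * B ≡ - n + x + y - z × C ≡ - n + y))
    ×
    (Δ < 0ℤ →
    ∃[ N ] (N-root (+ 4 * m) (- n) N × h̃± (- (+ 4) * (n ^ 2 - m)) N))
theorem4p1 m n 0<n with φ , φ-spec ← correspondence m n 0<n =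
  (φ , λ w x y z r → quadruple-inverse n (φ-spec ((w ∷ x ∷ y ∷ z ∷ []) , r))) ,
  -- The reduced forms are counted first; composing with `φ` gives the root quadruples the same `N`.
  λ Δ<0 → let N , h = class-number Δ<0 in
    N , Composition.bijection φ h , subst (λ Δ → h̃± Δ N) (Δ-identity (n ^ 2) m) h
  where
  Δ-identity : ∀ s m → - (+ 4) * s + + 4 * m ≡ - (+ 4) * (s - m)
  Δ-identity = solve-∀
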